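{- Let $P$ be a finite poset that is a block. Then: (S1) if $\dim_2(P)=|P|$, then $P\in\mathbb{A}_{2,3,4}\cup\mathbb{B}\cup\{Z\}$; (S2) if $\operatorname{cw}(P)=|P|$, then $P\in\mathbb{A}\cup\mathbb{B}\cup\{Z\}$.
   Context: An inclusion representation of $P$ is a family $(S_x:x\in P)$ of sets with $x\le y$ iff $S_x\subseteq S_y$; its ground set is $\bigcup_xS_x$. $\dim_2(P)$ is the least size of the ground set of an inclusion representation of $P$. $\operatorname{ch}(P)$ is the least $h$ such that some inclusion representation has all $|S_x|\le h$; $\operatorname{cw}(P)$ is the least ground-set size of an inclusion representation with all $|S_x|\le\operatorname{ch}(P)$. The vertical sum $Q_1<Q_2$ of disjoint posets is their union with the orders of $Q_1,Q_2$ and additionally every element of $Q_1$ below every element of $Q_2$. A block is a poset that is a chain or cannot be written as $Q_1<Q_2$ with $Q_1,Q_2$ non-empty. The disjoint sum $C+T$ is the union of $C$ and $T$ with no comparabilities between them. $Z$ is the four-element poset with three components. $\mathbb{A}$ is the set of antichains with at least two elements; $\mathbb{A}_{2,3,4}$ the antichains of sizes 2, 3, 4; $\mathbb{B}$ the posets $C+T$ with $C$ a chain with at least two elements and $T$ a one-element poset. -}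

module Defs where

open import Data.Nat using (ℕ; zero; suc; _≤_; _<_)
open import Data.Fin using (Fin; toℕ; fromℕ; inject₁)
open import Data.Fin.Subset using (Subset; _⊆_; ⋃; ∣_∣; _∈_; _∉_)
open import Data.List using (List)
open import Data.List.Base using (tabulate)
open import Data.Product using (Σ; ∃; _×_; _,_)
open import Data.Sum using (_⊎_)
open import Relation.Binary.Core using (Rel)
open import Relation.Binary.Structures using (IsPartialOrder)
open import Relation.Binary.PropositionalEquality using (_≡_)
open import Relation.Nullary using (¬_)
open import Level using (0ℓ)

record FinPoset (n : ℕ) : Set₁ where
  field
    _≤P_      : Rel (Fin n) 0ℓ
    isPartialOrder : IsPartialOrder _≡_ _≤P_
open FinPoset public

IsInclusionRep : ∀ {n} (P : FinPoset n) {m : ℕ} → (Fin n → Subset m) → Set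
IsInclusionRep P S = ∀ x y → (_≤P_ P x y → S x ⊆ S y) × (S x ⊆ S y → _≤P_ P x y)

ground : ∀ {n m} → (Fin n → Subset m) → Subset m
ground S = ⋃ (tabulate S)

Bounded : ∀ {n m} → ℕ → (Fin n → Subset m) → Set
Bounded h S = ∀ x → ∣ S x ∣ ≤ h

IsDim2 : ∀ {n} → FinPoset n → ℕ → Set
IsDim2 P d =
  (Σ ℕ λ m → Σ (Fin _ → Subset m) λ S → IsInclusionRep P S × ∣ ground S ∣ ≡ d)
  × (∀ m (S : Fin _ → Subset m) → IsInclusionRep P S → d ≤ ∣ ground S ∣)

IsCh : ∀ {n} → FinPoset n → ℕ → Set
IsCh P h =
  (Σ ℕ λ m → Σ (Fin _ → Subset m) λ S → IsInclusionRep P S × Bounded h S)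
  × (∀ m (S : Fin _ → Subset m) → IsInclusionRep P S → ∀ h' → Bounded h' S → h ≤ h')

IsCw : ∀ {n} → FinPoset n → ℕ → Set
IsCw P w = Σ ℕ λ h → IsCh P h ×
  ( (Σ ℕ λ m → Σ (Fin _ → Subset m) λ S →
        IsInclusionRep P S × Bounded h S × ∣ ground S ∣ ≡ w)
  × (∀ m (S : Fin _ → Subset m) → IsInclusionRep P S → Bounded h S → w ≤ ∣ ground S ∣))

IsChain : ∀ {n} → FinPoset n → Set
IsChain P = ∀ x y → _≤P_ P x y ⊎ _≤P_ P y x

-- P = Q₁ < Q₂ with Q₁ = A, Q₂ = complement of A, both non-empty
-- (the orders on Q₁, Q₂ are then the induced ones).
IsVerticalSum : ∀ {n} → FinPoset n → Set
IsVerticalSum {n} P = Σ (Subset n) λ A →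
  (∃ λ x → x ∈ A) × (∃ λ y → y ∉ A) × (∀ x y → x ∈ A → y ∉ A → _≤P_ P x y)

IsBlock : ∀ {n} → FinPoset n → Set
IsBlock P = IsChain P ⊎ ¬ IsVerticalSum P

record _≅_ {n m} (P : FinPoset n) (R : Rel (Fin m) 0ℓ) : Set where
  field
    to      : Fin n → Fin m
    from    : Fin m → Fin n
    from-to : ∀ x → from (to x) ≡ x
    to-from : ∀ y → to (from y) ≡ y
    mono    : ∀ x y → _≤P_ P x y → R (to x) (to y)
    reflect : ∀ x y → R (to x) (to y) → _≤P_ P x y

antichainRel : ∀ k → Rel (Fin k) 0ℓ
antichainRel k x y = x ≡ y

-- C + T with C a chain on the first c elements (natural order) and
-- T = {the last element c} of Fin (suc c).
chainPlusPointRel : ∀ c → Rel (Fin (suc c)) 0ℓ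
chainPlusPointRel c x y =
  (¬ (x ≡ fromℕ c) × ¬ (y ≡ fromℕ c) × toℕ x ≤ toℕ y) ⊎ x ≡ y

ZRel : Rel (Fin 4) 0ℓ
ZRel x y = (toℕ x ≡ 0 × toℕ y ≡ 1) ⊎ x ≡ y

InA234 : ∀ {n} → FinPoset n → Set
InA234 P = Σ ℕ λ k → (k ≡ 2 ⊎ k ≡ 3 ⊎ k ≡ 4) × (P ≅ antichainRel k)

InA : ∀ {n} → FinPoset n → Set
InA P = Σ ℕ λ k → 2 ≤ k × (P ≅ antichainRel k)

InB : ∀ {n} → FinPoset n → Set
InB P = Σ ℕ λ c → 2 ≤ c × (P ≅ chainPlusPointRel c)

IsZ : ∀ {n} → FinPoset n → Set
IsZ P = P ≅ ZRel

{-# OPTIONS --safe #-}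
{- The representation by principal down-sets ↓ x has ground set of size |P| and bound max |↓ x|.
If cw P = |P|, this bound equals ch P: for a representation S, call (C , X) a cover if every
ground element g ∉ C is generated by X, that is, the up-set { w | g ∈ S w } is the union of the
principal up-sets of those x ∈ X which it contains.  A cover yields the representation
w ↦ (S w ∩ C) + (↓ w ∩ X) with |C| + |X| ground elements, and if its sets at some w are larger than
S w, then (C ∪ S w , X ∖ ↓ w) is a smaller cover.  If |S z| < |↓ z| for some z, then
(S z , P ∖ ↓ z) is a cover of size < |P|, and shrinking it contradicts minimality.

Hence for (S1) and (S2) alike one looks, in every block that is neither listed nor an antichain, for
a representation with fewer than |P| ground elements and all sets of size at most
max |↓ x|.  Either some element can be dropped from all down-sets, or the set of one maximal element
can be replaced by one that avoids it, or P is a chain plus isolated points.  Take x with |↓ x|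
maximal: unless the second option applies, the elements outside ↓ x are maximal and all have the
same strict down-set D (or P is an antichain), and unless the first applies, ↓ x ∖ D is a chain
above D.  Since P is not a vertical sum, D is empty.  For (S1), five elements of a larger antichain
are represented by 2-subsets of a 4-set. -}

module Submission where

open import Defs
open import Data.Nat using (ℕ; zero; suc; _≤_; _<_; _+_; _∸_; z≤n; s≤s)
import Data.Nat.Properties as ℕₚ
open import Data.Nat.Induction using (<-wellFounded)
open import Induction.WellFounded using (Acc; acc)
open import Data.Product using (_×_; _,_; ∃; Σ; proj₁; proj₂)
open import Data.Sum using (_⊎_; inj₁; inj₂)
open import Data.Bool using (true; false)
open import Data.Fin using (Fin; zero; suc; toℕ; fromℕ; fromℕ<; punchOut; join; splitAt)
open import Data.Fin.Properties using
  (_≟_; any?; all?; toℕ-injective; toℕ-fromℕ; toℕ-fromℕ<; join-splitAt; punchOut-injective; <⇒notInjective)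
open import Data.Fin.Subset using (Subset; _⊆_; _∈_; _∉_; ∣_∣; ⁅_⁆; _∪_; _∩_; _─_; ∁; inside; outside)
  renaming (⊥ to ∅)
open import Data.Fin.Subset.Properties
open import Data.Vec using (Vec; []; _∷_; _++_; tabulate; lookup; here; there)
open import Data.Vec.Properties using (lookup⇒[]=; []=⇒lookup; lookup∘tabulate)
open import Data.List.Base using (allFin)
open import Data.List.Extrema.Nat using (argmax; f[xs]≤f[argmax])
open import Data.List.Membership.Propositional.Properties using (∈-allFin)
import Data.List.Relation.Unary.All as All
open import Function using (_∘_; case_of_; id)
open import Level using (0ℓ)
open import Relation.Binary.Definitions using (Decidable)
open import Relation.Binary.Structures using (IsPartialOrder)
open import Relation.Binary.PropositionalEquality using (_≡_; _≢_; refl; sym; trans; cong; cong₂; subst; subst₂)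
open import Relation.Nullary using (¬_; yes; no; does; contradiction)
open import Relation.Nullary.Decidable using (_×-dec_; _→-dec_; ¬?; dec-true; dec-false; decidable-stable; from-yes)
open import Relation.Unary using (Pred) renaming (Decidable to Decidable₁)

private variable
  m n : ℕ

-- Finite subsets: selection, cardinality, concatenation, extrema.

select : {Q : Pred (Fin n) 0ℓ} → Decidable₁ Q → Subset n
select Q? = tabulate (does ∘ Q?)

module _ {Q : Pred (Fin n) 0ℓ} (Q? : Decidable₁ Q) where

  ∈-select⁺ : ∀ {x} → Q x → x ∈ select Q?
  ∈-select⁺ {x} q = lookup⇒[]= x _ (trans (lookup∘tabulate _ x) (dec-true (Q? x) q))

  ∈-select⁻ : ∀ {x} → x ∈ select Q? → Q x
  ∈-select⁻ {x} x∈ = decidable-stable (Q? x) λ ¬q →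
    case trans (sym (dec-false (Q? x) ¬q)) (trans (sym (lookup∘tabulate _ x)) ([]=⇒lookup x∈)) of λ ()

  search : ∃ Q ⊎ (∀ x → ¬ Q x)
  search with any? Q?
  ... | yes q = inj₁ q
  ... | no ¬q = inj₂ λ x qx → ¬q (x , qx)

-- Inclusion-exclusion without subtraction; writing `q ∩ p` rather than `p ∩ q` fits the term
-- `S w ∩ C` in `smaller`.
∣p∪q∣+∣q∩p∣ : ∀ (p q : Subset n) → ∣ p ∪ q ∣ + ∣ q ∩ p ∣ ≡ ∣ p ∣ + ∣ q ∣
∣p∪q∣+∣q∩p∣ []          []          = refl
∣p∪q∣+∣q∩p∣ (true  ∷ p) (true  ∷ q) =
  cong suc (trans (ℕₚ.+-suc _ _) (trans (cong suc (∣p∪q∣+∣q∩p∣ p q)) (sym (ℕₚ.+-suc _ _))))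
∣p∪q∣+∣q∩p∣ (true  ∷ p) (false ∷ q) = cong suc (∣p∪q∣+∣q∩p∣ p q)
∣p∪q∣+∣q∩p∣ (false ∷ p) (true  ∷ q) = trans (cong suc (∣p∪q∣+∣q∩p∣ p q)) (sym (ℕₚ.+-suc _ _))
∣p∪q∣+∣q∩p∣ (false ∷ p) (false ∷ q) = ∣p∪q∣+∣q∩p∣ p q

∣p─q∣+∣q∩p∣ : ∀ (p q : Subset n) → ∣ p ─ q ∣ + ∣ q ∩ p ∣ ≡ ∣ p ∣
∣p─q∣+∣q∩p∣ []          []          = refl
∣p─q∣+∣q∩p∣ (true  ∷ p) (true  ∷ q) = trans (ℕₚ.+-suc _ _) (cong suc (∣p─q∣+∣q∩p∣ p q))
∣p─q∣+∣q∩p∣ (true  ∷ p) (false ∷ q) = cong suc (∣p─q∣+∣q∩p∣ p q)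
∣p─q∣+∣q∩p∣ (false ∷ p) (true  ∷ q) = ∣p─q∣+∣q∩p∣ p q
∣p─q∣+∣q∩p∣ (false ∷ p) (false ∷ q) = ∣p─q∣+∣q∩p∣ p q

∣p∪q∣≤∣p∣+∣q∣ : ∀ (p q : Subset n) → ∣ p ∪ q ∣ ≤ ∣ p ∣ + ∣ q ∣
∣p∪q∣≤∣p∣+∣q∣ p q = subst (∣ p ∪ q ∣ ≤_) (∣p∪q∣+∣q∩p∣ p q) (ℕₚ.m≤m+n _ _)

∣p∪⁅x⁆∣≤ : ∀ (p : Subset n) x → ∣ p ∪ ⁅ x ⁆ ∣ ≤ suc ∣ p ∣
∣p∪⁅x⁆∣≤ p x = subst (∣ p ∪ ⁅ x ⁆ ∣ ≤_)
  (trans (cong (∣ p ∣ +_) (∣⁅x⁆∣≡1 x)) (ℕₚ.+-comm _ 1)) (∣p∪q∣≤∣p∣+∣q∣ p ⁅ x ⁆)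

∣p++q∣ : ∀ (p : Subset m) (q : Subset n) → ∣ p ++ q ∣ ≡ ∣ p ∣ + ∣ q ∣
∣p++q∣ []          q = refl
∣p++q∣ (true  ∷ p) q = cong suc (∣p++q∣ p q)
∣p++q∣ (false ∷ p) q = ∣p++q∣ p q

++-⊆⁺ : ∀ {p p′ : Subset m} {q q′ : Subset n} → p ⊆ p′ → q ⊆ q′ → p ++ q ⊆ p′ ++ q′
++-⊆⁺ {p = []}    {[]}    ps qs x∈         = qs x∈
++-⊆⁺ {p = _ ∷ _} {_ ∷ _} ps qs here       with here ← ps here = here
++-⊆⁺ {p = _ ∷ p} {_ ∷ _} ps qs (there x∈) = there (++-⊆⁺ {p = p} (drop-∷-⊆ ps) qs x∈)

++-⊆⁻ : ∀ (p p′ : Subset m) {q q′ : Subset n} → p ++ q ⊆ p′ ++ q′ → p ⊆ p′ × q ⊆ q′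
++-⊆⁻ []      []       s = (λ ()) , s
++-⊆⁻ (a ∷ p) (b ∷ p′) s = head , proj₂ (++-⊆⁻ p p′ (drop-∷-⊆ s))
  where
  head : a ∷ p ⊆ b ∷ p′
  head here       with here ← s here = here
  head (there x∈) = there (proj₁ (++-⊆⁻ p p′ (drop-∷-⊆ s)) x∈)

ground-⊆ : ∀ (S : Fin n → Subset m) {q} → (∀ x → S x ⊆ q) → ground S ⊆ q
ground-⊆ {zero}  S S⊆q x∈ = contradiction x∈ ∉⊥
ground-⊆ {suc n} S S⊆q x∈ with x∈p∪q⁻ (S zero) _ x∈
... | inj₁ x∈S = S⊆q zero x∈S
... | inj₂ x∈⋃ = ground-⊆ (S ∘ suc) (S⊆q ∘ suc) x∈⋃

∣∁∣+∣∣ : ∀ (p : Subset n) → ∣ ∁ p ∣ + ∣ p ∣ ≡ n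
∣∁∣+∣∣ p = trans (cong (_+ ∣ p ∣) (∣∁p∣≡n∸∣p∣ p)) (ℕₚ.m∸n+n≡m (∣p∣≤n p))

∣p∣<n : ∀ (p : Subset n) {x} → x ∉ p → ∣ p ∣ < n
∣p∣<n {n} p {x} x∉p = subst (∣ p ∣ <_) (∣⊤∣≡n n) (p⊂q⇒∣p∣<∣q∣ ((λ _ → ∈⊤) , x , ∈⊤ , x∉p))

maximum : (f : Fin n → ℕ) → Fin n → ∃ λ x → ∀ y → f y ≤ f x
maximum f x₀ = argmax f x₀ (allFin _) , λ y → All.lookup (f[xs]≤f[argmax] {f = f} x₀ (allFin _)) (∈-allFin y)

-- Pigeonhole: punching out a missed value would inject `Fin (suc n)` into `Fin n`.
injective⇒surjective : (f : Fin n → Fin n) → (∀ {i j} → f i ≡ f j → i ≡ j) → ∀ j → ∃ λ i → f i ≡ j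
injective⇒surjective {suc n} f injective j with any? (λ i → f i ≟ j)
... | yes hit = hit
... | no miss = contradiction
  (λ {i} {i′} eq → injective (punchOut-injective (j≢f i) (j≢f i′) eq))
  (<⇒notInjective {f = λ i → punchOut (j≢f i)} (ℕₚ.n<1+n n))
  where
  j≢f : ∀ i → j ≢ f i
  j≢f i refl = miss (i , refl)

-- Strict order and principal down-sets.

module Poset {n : ℕ} (P : FinPoset n) (_⊑?_ : Decidable (_≤P_ P)) where

  open IsPartialOrder (isPartialOrder P) public
    using (antisym) renaming (refl to ⊑-refl; trans to ⊑-trans)

  infix 4 _⊑_ _⊏_

  _⊑_ _⊏_ : Fin n → Fin n → Set
  _⊑_ = _≤P_ P
  x ⊏ y = x ⊑ y × x ≢ y

  _⊏?_ : Decidable _⊏_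
  x ⊏? y = (x ⊑? y) ×-dec ¬? (x ≟ y)

  ⊑⇒⊏⊎≡ : ∀ {x y} → x ⊑ y → x ⊏ y ⊎ x ≡ y
  ⊑⇒⊏⊎≡ {x} {y} x⊑y with x ≟ y
  ... | yes x≡y = inj₂ x≡y
  ... | no  x≢y = inj₁ (x⊑y , x≢y)

  ⊑-⊏-trans : ∀ {x y z} → x ⊑ y → y ⊏ z → x ⊏ z
  ⊑-⊏-trans x⊑y (y⊑z , y≢z) = ⊑-trans x⊑y y⊑z , λ { refl → y≢z (antisym y⊑z x⊑y) }

  ↓ ↓° : Fin n → Subset n
  ↓  y = select (_⊑? y)
  ↓° y = select (_⊏? y)

  ∈↓⁺ : ∀ {x y} → x ⊑ y → x ∈ ↓ y
  ∈↓⁺ {y = y} = ∈-select⁺ (_⊑? y)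

  ∈↓⁻ : ∀ {x y} → x ∈ ↓ y → x ⊑ y
  ∈↓⁻ {y = y} = ∈-select⁻ (_⊑? y)

  ∈↓°⁺ : ∀ {x y} → x ⊏ y → x ∈ ↓° y
  ∈↓°⁺ {y = y} = ∈-select⁺ (_⊏? y)

  ∈↓°⁻ : ∀ {x y} → x ∈ ↓° y → x ⊏ y
  ∈↓°⁻ {y = y} = ∈-select⁻ (_⊏? y)

  ↓-mono : ∀ {x y} → x ⊑ y → ↓ x ⊆ ↓ y
  ↓-mono x⊑y z∈ = ∈↓⁺ (⊑-trans (∈↓⁻ z∈) x⊑y)

  ∣↓∣-mono-⊏ : ∀ {x y} → x ⊏ y → ∣ ↓ x ∣ < ∣ ↓ y ∣
  ∣↓∣-mono-⊏ (x⊑y , x≢y) = p⊂q⇒∣p∣<∣q∣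
    (↓-mono x⊑y , _ , ∈↓⁺ ⊑-refl , λ y∈ → x≢y (antisym x⊑y (∈↓⁻ y∈)))

  ∣↓°∣<∣↓∣ : ∀ x → ∣ ↓° x ∣ < ∣ ↓ x ∣
  ∣↓°∣<∣↓∣ x = p⊂q⇒∣p∣<∣q∣
    ((λ z∈ → ∈↓⁺ (proj₁ (∈↓°⁻ z∈))) , x , ∈↓⁺ ⊑-refl , λ x∈ → proj₂ (∈↓°⁻ x∈) refl)

  ∣↓∣≤1+∣↓°∣ : ∀ x → ∣ ↓ x ∣ ≤ suc ∣ ↓° x ∣
  ∣↓∣≤1+∣↓°∣ x = ℕₚ.≤-trans (p⊆q⇒∣p∣≤∣q∣ sub) (∣p∪⁅x⁆∣≤ (↓° x) x)
    where
    sub : ↓ x ⊆ ↓° x ∪ ⁅ x ⁆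
    sub z∈ with ⊑⇒⊏⊎≡ (∈↓⁻ z∈)
    ... | inj₁ z⊏x  = x∈p∪q⁺ (inj₁ (∈↓°⁺ z⊏x))
    ... | inj₂ refl = x∈p∪q⁺ (inj₂ (x∈⁅x⁆ x))

  -- Covers, and down-sets against minimal representations.

  module Cover {m} (S : Fin n → Subset m) (rep : IsInclusionRep P S) where

    S-mono : ∀ {x y} → x ⊑ y → S x ⊆ S y
    S-mono = proj₁ (rep _ _)

    Cover : Subset m → Subset n → Set
    Cover C X = ∀ {g w} → g ∉ C → g ∈ S w → ∃ λ x → x ∈ X × x ⊑ w × g ∈ S x

    coverRep : Subset m → Subset n → Fin n → Subset (m + n)
    coverRep C X w = (S w ∩ C) ++ (↓ w ∩ X)

    -- For the backward direction, elements of `S y` in `C` are compared directly. Any other `g` has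
    -- a generator `x ⊑ y`, and the presence of `x` in `↓ w` puts `g` into `S w`.
    coverRep-rep : ∀ {C X} → Cover C X → IsInclusionRep P (coverRep C X)
    coverRep-rep {C} {X} cover y w = fwd , bwd
      where
      fwd : y ⊑ w → coverRep C X y ⊆ coverRep C X w
      fwd y⊑w = ++-⊆⁺ {p = S y ∩ C}
        (λ g∈ → let g∈S , g∈C = x∈p∩q⁻ (S y) C g∈ in x∈p∩q⁺ (S-mono y⊑w g∈S , g∈C))
        (λ x∈ → let x∈↓ , x∈X = x∈p∩q⁻ (↓ y) X x∈ in x∈p∩q⁺ (↓-mono y⊑w x∈↓ , x∈X))

      bwd : coverRep C X y ⊆ coverRep C X w → y ⊑ w
      bwd s = let s′ = ++-⊆⁻ (S y ∩ C) (S w ∩ C) s in proj₂ (rep y w) λ {g} g∈S → case g ∈? C of λ where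
        (yes g∈C) → proj₁ (x∈p∩q⁻ (S w) C (proj₁ s′ (x∈p∩q⁺ (g∈S , g∈C))))
        (no  g∉C) → let x , x∈X , x⊑y , g∈Sx = cover g∉C g∈S in
          S-mono (∈↓⁻ (proj₁ (x∈p∩q⁻ (↓ w) X (proj₂ s′ (x∈p∩q⁺ (∈↓⁺ x⊑y , x∈X)))))) g∈Sx

    coverRep-ground : ∀ C X → ∣ ground (coverRep C X) ∣ ≤ ∣ C ∣ + ∣ X ∣
    coverRep-ground C X = subst (∣ ground (coverRep C X) ∣ ≤_) (∣p++q∣ C X)
      (p⊆q⇒∣p∣≤∣q∣ (ground-⊆ (coverRep C X)
        λ w → ++-⊆⁺ {p = S w ∩ C} (p∩q⊆q (S w) C) (p∩q⊆q (↓ w) X)))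

    -- Lets `coverRep C X` inherit every bound on the sizes of the sets of `S`.
    Economical : Subset m → Subset n → Set
    Economical C X = ∀ w → ∣ S w ∩ C ∣ + ∣ ↓ w ∩ X ∣ ≤ ∣ S w ∣

    -- The new pair gains `S w ─ C` and loses `↓ w ∩ X`, and `lt` says that the loss exceeds the
    -- gain. Adding `∣ S w ∣` on both sides avoids truncated subtraction.
    smaller : ∀ w C X → ∣ S w ∣ < ∣ S w ∩ C ∣ + ∣ ↓ w ∩ X ∣ →
              ∣ C ∪ S w ∣ + ∣ X ─ ↓ w ∣ < ∣ C ∣ + ∣ X ∣
    smaller w C X lt = ℕₚ.+-cancelʳ-< ∣ S w ∣ _ _ (begin-strict
      (∣ C ∪ S w ∣ + ∣ X ─ ↓ w ∣) + ∣ S w ∣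
        <⟨ ℕₚ.+-monoʳ-< (∣ C ∪ S w ∣ + ∣ X ─ ↓ w ∣) lt ⟩
      (∣ C ∪ S w ∣ + ∣ X ─ ↓ w ∣) + (∣ S w ∩ C ∣ + ∣ ↓ w ∩ X ∣)
        ≡⟨ interchange (∣ C ∪ S w ∣) (∣ X ─ ↓ w ∣) (∣ S w ∩ C ∣) (∣ ↓ w ∩ X ∣) ⟩
      (∣ C ∪ S w ∣ + ∣ S w ∩ C ∣) + (∣ X ─ ↓ w ∣ + ∣ ↓ w ∩ X ∣)
        ≡⟨ cong₂ _+_ (∣p∪q∣+∣q∩p∣ C (S w)) (∣p─q∣+∣q∩p∣ X (↓ w)) ⟩
      (∣ C ∣ + ∣ S w ∣) + ∣ X ∣
        ≡⟨ ℕₚ.+-assoc ∣ C ∣ _ _ ⟩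
      ∣ C ∣ + (∣ S w ∣ + ∣ X ∣)
        ≡⟨ cong (∣ C ∣ +_) (ℕₚ.+-comm ∣ S w ∣ _) ⟩
      ∣ C ∣ + (∣ X ∣ + ∣ S w ∣)
        ≡⟨ ℕₚ.+-assoc ∣ C ∣ _ _ ⟨
      (∣ C ∣ + ∣ X ∣) + ∣ S w ∣ ∎)
      where
      open ℕₚ.≤-Reasoning
      open import Algebra.Properties.CommutativeSemigroup ℕₚ.+-commutativeSemigroup using (interchange)

    -- Each repair at a violating `w` lowers the weight `∣ C ∣ + ∣ X ∣`, so the process stops at an
    -- economical cover.
    economize : ∀ C X → Cover C X → Acc _<_ (∣ C ∣ + ∣ X ∣) →
      ∃ λ C′ → ∃ λ X′ → Cover C′ X′ × Economical C′ X′ × ∣ C′ ∣ + ∣ X′ ∣ ≤ ∣ C ∣ + ∣ X ∣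
    economize C X cover (acc rs) with search (λ w → ∣ S w ∣ ℕₚ.<? ∣ S w ∩ C ∣ + ∣ ↓ w ∩ X ∣)
    ... | inj₂ none = C , X , cover , (λ w → ℕₚ.≮⇒≥ (none w)) , ℕₚ.≤-refl
    ... | inj₁ (w , lt) =
      let C′ , X′ , cover′ , econ , le = economize (C ∪ S w) (X ─ ↓ w) cover⁺ (rs (smaller w C X lt))
      in  C′ , X′ , cover′ , econ , ℕₚ.≤-trans le (ℕₚ.<⇒≤ (smaller w C X lt))
      where
      cover⁺ : Cover (C ∪ S w) (X ─ ↓ w)
      -- A generator in `↓ w` would force `g ∈ S w`; hence the generator of a `g` outside `C ∪ S w`
      -- survives in `X ─ ↓ w`.
      cover⁺ g∉ g∈Sv = let x , x∈X , x⊑v , g∈Sx = cover (g∉ ∘ x∈p∪q⁺ ∘ inj₁) g∈Sv in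
        x , x∈p∧x∉q⇒x∈p─q x∈X (λ x∈↓w → g∉ (x∈p∪q⁺ (inj₂ (S-mono (∈↓⁻ x∈↓w) g∈Sx)))) , x⊑v , g∈Sx

    ∣↓∣≤∣S∣ : ∀ {h} → Bounded h S →
      (∀ m′ (S′ : Fin n → Subset m′) → IsInclusionRep P S′ → Bounded h S′ → n ≤ ∣ ground S′ ∣) →
      ∀ z → ∣ ↓ z ∣ ≤ ∣ S z ∣
    ∣↓∣≤∣S∣ {h} bounded minimal z = ℕₚ.≮⇒≥ λ lt →
      let C , X , cover , econ , le = economize (S z) (∁ (↓ z)) start (<-wellFounded _)
      in ℕₚ.<-irrefl refl (ℕₚ.≤-<-trans
           (ℕₚ.≤-trans
             (minimal _ (coverRep C X) (coverRep-rep cover)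
               (λ w → ℕₚ.≤-trans (ℕₚ.≤-reflexive (∣p++q∣ (S w ∩ C) (↓ w ∩ X)))
                       (ℕₚ.≤-trans (econ w) (bounded w))))
             (ℕₚ.≤-trans (coverRep-ground C X) le))
           -- The initial weight is below `∣ ↓ z ∣ + ∣ ∁ (↓ z) ∣ = n`.
           (subst (∣ S z ∣ + ∣ ∁ (↓ z) ∣ <_) (trans (ℕₚ.+-comm ∣ ↓ z ∣ _) (∣∁∣+∣∣ (↓ z)))
             (ℕₚ.+-monoˡ-< ∣ ∁ (↓ z) ∣ lt)))
      where
      start : Cover (S z) (∁ (↓ z))
      -- Every `w` outside `↓ z` is its own generator.
      start {w = w} g∉Sz g∈Sw = w , x∉p⇒x∈∁p (λ w∈ → g∉Sz (S-mono (∈↓⁻ w∈) g∈Sw)) , ⊑-refl , g∈Sw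

  -- Representations that improve on the one by down-sets.

  Improved : Set
  Improved = Σ ℕ λ m → Σ (Fin n → Subset m) λ S →
    -- Sizes are measured against down-sets instead of `ch P`, so that a single notion serves both
    -- dimensions.
    IsInclusionRep P S × (∀ x → ∃ λ y → ∣ S x ∣ ≤ ∣ ↓ y ∣) × ∣ ground S ∣ < n

  avoids⇒∣ground∣< : ∀ (S : Fin n → Subset n) o → (∀ x → o ∉ S x) → ∣ ground S ∣ < n
  avoids⇒∣ground∣< S o o∉S = ∣p∣<n (ground S) λ o∈ →
    x∈p⇒x∉∁p (x∈⁅x⁆ o)
      (ground-⊆ S {∁ ⁅ o ⁆} (λ x y∈ → x∉p⇒x∈∁p λ y∈⁅o⁆ → o∉S x (subst (_∈ S x) (x∈⁅y⁆⇒x≡y o y∈⁅o⁆) y∈)) o∈)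

  -- That is, `z` is the join of the elements strictly below it; a minimal `z` qualifies only as
  -- least element.
  Redundant : Fin n → Set
  Redundant z = ∀ y → (∀ w → w ⊏ z → w ⊑ y) → z ⊑ y

  redundant? : Decidable₁ Redundant
  redundant? z = all? λ y → all? (λ w → (w ⊏? z) →-dec (w ⊑? y)) →-dec (z ⊑? y)

  -- Deleting `z` endangers only comparisons `z ⊑ w`, and these are recovered from the elements
  -- strictly below `z`.
  dropRedundant : ∀ {z} → Redundant z → Improved
  dropRedundant {z} redundant = n , S , rep ,
    (λ y → y , ∣p∩q∣≤∣p∣ (↓ y) (∁ ⁅ z ⁆)) ,
    avoids⇒∣ground∣< S z (λ y z∈ → x∈p⇒x∉∁p (x∈⁅x⁆ z) (proj₂ (x∈p∩q⁻ (↓ y) (∁ ⁅ z ⁆) z∈)))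
    where
    S : Fin n → Subset n
    S y = ↓ y ∩ ∁ ⁅ z ⁆

    ∈S⁺ : ∀ {x y} → x ⊑ y → x ≢ z → x ∈ S y
    ∈S⁺ x⊑y x≢z = x∈p∩q⁺ (∈↓⁺ x⊑y , x∉p⇒x∈∁p (x≢y⇒x∉⁅y⁆ x≢z))

    ∈S⁻ : ∀ {x} y → x ∈ S y → x ⊑ y
    ∈S⁻ y x∈ = ∈↓⁻ (proj₁ (x∈p∩q⁻ (↓ y) (∁ ⁅ z ⁆) x∈))

    bwd : ∀ y w → S y ⊆ S w → y ⊑ w
    bwd y w s with y ≟ z
    ... | yes refl = redundant w λ v (v⊑z , v≢z) → ∈S⁻ w (s (∈S⁺ v⊑z v≢z))
    ... | no  y≢z  = ∈S⁻ w (s (∈S⁺ ⊑-refl y≢z))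

    rep : IsInclusionRep P S
    rep y w = (λ y⊑w x∈ → let x∈↓ , x∈∁ = x∈p∩q⁻ (↓ y) (∁ ⁅ z ⁆) x∈ in x∈p∩q⁺ (↓-mono y⊑w x∈↓ , x∈∁)) ,
              bwd y w

  -- The maximal `q` occurs in no down-set but its own. Replacing that one by `A` removes `q` from
  -- the ground set, and the conditions on `A` preserve every comparison with `q`.
  module _ {q : Fin n} (A : Subset n)
    (q-maximal : ∀ {y} → q ⊑ y → q ≡ y)
    (q∉A : q ∉ A)
    (↓°q⊆A : ∀ {y} → y ⊏ q → y ∈ A)
    (A⊈↓ : ∀ {y} → y ≢ q → ¬ A ⊆ ↓ y)
    (↓⊈A : ∀ {y} → ¬ y ⊑ q → ¬ ↓ y ⊆ A)
    {x : Fin n} (∣A∣≤∣↓x∣ : ∣ A ∣ ≤ ∣ ↓ x ∣) where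

    private
      S : Fin n → Subset n
      S y with y ≟ q
      ... | yes _ = A
      ... | no  _ = ↓ y

      q∉S : ∀ y → q ∉ S y
      q∉S y with y ≟ q
      ... | yes _  = q∉A
      ... | no y≢q = λ q∈ → y≢q (sym (q-maximal (∈↓⁻ q∈)))

      S-bound : ∀ y → ∃ λ w → ∣ S y ∣ ≤ ∣ ↓ w ∣
      S-bound y with y ≟ q
      ... | yes _ = x , ∣A∣≤∣↓x∣
      ... | no  _ = y , ℕₚ.≤-refl

      rep : IsInclusionRep P S
      rep y w with y ≟ q | w ≟ q
      ... | yes refl | yes refl = (λ _ z∈ → z∈) , λ _ → ⊑-refl
      ... | yes refl | no  w≢q  = (λ q⊑w → contradiction (sym (q-maximal q⊑w)) w≢q) ,
                                  λ s → contradiction (λ {_} → s) (A⊈↓ w≢q)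
      ... | no  y≢q  | yes refl = (λ y⊑q z∈ → ↓°q⊆A (⊑-⊏-trans (∈↓⁻ z∈) (y⊑q , y≢q))) ,
                                  λ s → decidable-stable (y ⊑? q) λ y⋢q → ↓⊈A y⋢q s
      ... | no  y≢q  | no  w≢q  = ↓-mono , λ s → ∈↓⁻ (s (∈↓⁺ ⊑-refl))

    replaceMaximal : Improved
    replaceMaximal = n , S , rep , S-bound , avoids⇒∣ground∣< S q q∉S

  module _ {x : Fin n}
    (isolated : ∀ {r w} → ¬ r ⊑ x → w ⊑ r → w ≡ r)
    (2≤∣↓x∣ : 2 ≤ ∣ ↓ x ∣)
    (a b : Fin n → Fin n)
    (a⋢x : ∀ {i} → ¬ i ⊑ x → ¬ a i ⊑ x)
    (b-nonminimal : ∀ {i} → ¬ i ⊑ x → b i ⊑ x → ∃ λ e → e ⊏ b i)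
    (antichain : ∀ {i j} → ¬ i ⊑ x → ¬ j ⊑ x → i ≢ j →
                 ¬ ((a i ≡ a j ⊎ a i ≡ b j) × (b i ≡ a j ⊎ b i ≡ b j)))
    {o : Fin n} (o⋢x : ¬ o ⊑ x) (o≢a : ∀ {i} → ¬ i ⊑ x → o ≢ a i) (o≢b : ∀ {i} → ¬ i ⊑ x → o ≢ b i) where

    private
      pair : Fin n → Subset n
      pair i = ⁅ a i ⁆ ∪ ⁅ b i ⁆

      ∈pair⁻ : ∀ {z} i → z ∈ pair i → z ≡ a i ⊎ z ≡ b i
      ∈pair⁻ i z∈ with x∈p∪q⁻ ⁅ a i ⁆ ⁅ b i ⁆ z∈
      ... | inj₁ z∈a = inj₁ (x∈⁅y⁆⇒x≡y _ z∈a)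
      ... | inj₂ z∈b = inj₂ (x∈⁅y⁆⇒x≡y _ z∈b)

      a∈pair : ∀ i → a i ∈ pair i
      a∈pair i = x∈p∪q⁺ (inj₁ (x∈⁅x⁆ (a i)))

      b∈pair : ∀ i → b i ∈ pair i
      b∈pair i = x∈p∪q⁺ (inj₂ (x∈⁅x⁆ (b i)))

      S : Fin n → Subset n
      S i with i ⊑? x
      ... | yes _ = ↓ i
      ... | no  _ = pair i

      o∉S : ∀ i → o ∉ S i
      o∉S i with i ⊑? x
      ... | yes i⊑x = λ o∈ → o⋢x (⊑-trans (∈↓⁻ o∈) i⊑x)
      ... | no  i⋢x = λ o∈ → case ∈pair⁻ i o∈ of λ where
        (inj₁ o≡a) → o≢a i⋢x o≡a
        (inj₂ o≡b) → o≢b i⋢x o≡b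

      S-bound : ∀ i → ∃ λ w → ∣ S i ∣ ≤ ∣ ↓ w ∣
      S-bound i with i ⊑? x
      ... | yes _ = i , ℕₚ.≤-refl
      ... | no  _ = x , ℕₚ.≤-trans
        (subst (λ k → ∣ pair i ∣ ≤ suc k) (∣⁅x⁆∣≡1 (a i)) (∣p∪⁅x⁆∣≤ ⁅ a i ⁆ (b i))) 2≤∣↓x∣

      ↓⊈pair : ∀ {y w} → y ⊑ x → ¬ w ⊑ x → ¬ ↓ y ⊆ pair w
      ↓⊈pair {y} {w} y⊑x w⋢x s with ∈pair⁻ w (s (∈↓⁺ ⊑-refl))
      ... | inj₁ refl = a⋢x w⋢x y⊑x
      ... | inj₂ refl with b-nonminimal w⋢x y⊑x
      ...   | e , e⊑b , e≢b with ∈pair⁻ w (s (∈↓⁺ e⊑b))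
      ...     | inj₁ refl = a⋢x w⋢x (⊑-trans e⊑b y⊑x)
      ...     | inj₂ e≡b  = e≢b e≡b

      rep : IsInclusionRep P S
      rep y w with y ⊑? x | w ⊑? x
      ... | yes y⊑x | yes w⊑x = ↓-mono , λ s → ∈↓⁻ (s (∈↓⁺ ⊑-refl))
      ... | yes y⊑x | no  w⋢x = (λ y⊑w → contradiction (subst (_⊑ x) (isolated w⋢x y⊑w) y⊑x) w⋢x) ,
                                λ s → contradiction (λ {_} → s) (↓⊈pair y⊑x w⋢x)
      ... | no  y⋢x | yes w⊑x = (λ y⊑w → contradiction (⊑-trans y⊑w w⊑x) y⋢x) ,
                                λ s → contradiction (⊑-trans (∈↓⁻ (s (a∈pair y))) w⊑x) (a⋢x y⋢x)
      ... | no  y⋢x | no  w⋢x = (λ y⊑w → subst (λ v → pair y ⊆ pair v) (isolated w⋢x y⊑w) (λ z∈ → z∈)) , bwd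
        where
        bwd : pair y ⊆ pair w → y ⊑ w
        bwd s with y ≟ w
        ... | yes refl = ⊑-refl
        ... | no  y≢w  = contradiction
          (∈pair⁻ w (s (a∈pair y)) , ∈pair⁻ w (s (b∈pair y))) (antichain y⋢x w⋢x y≢w)

    isolatedPairs : Improved
    isolatedPairs = n , S , rep , S-bound , avoids⇒∣ground∣< S o o∉S

-- Recognising `Z`.

module _ {n : ℕ} (P : FinPoset n) (_⊑?_ : Decidable (_≤P_ P)) where

  open Poset P _⊑?_

  module _ {x d q r : Fin n} (isolated : ∀ {r w} → ¬ r ⊑ x → w ⊑ r → w ≡ r)
    (d⊏x : d ⊏ x) (q⋢x : ¬ q ⊑ x) (r⋢x : ¬ r ⊑ x) (r≢q : r ≢ q)
    (covered : ∀ y → y ≡ d ⊎ y ≡ x ⊎ y ≡ q ⊎ y ≡ r) where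

    private
      element : Fin 4 → Fin n
      -- The chain `d ⊏ x` takes positions 0 and 1, as in `ZRel`.
      element = lookup (d ∷ x ∷ q ∷ r ∷ [])

      index : ∀ y → ∃ λ i → element i ≡ y
      index y with covered y
      ... | inj₁ refl               = zero , refl
      ... | inj₂ (inj₁ refl)        = suc zero , refl
      ... | inj₂ (inj₂ (inj₁ refl)) = suc (suc zero) , refl
      ... | inj₂ (inj₂ (inj₂ refl)) = suc (suc (suc zero)) , refl

      no-cross : ∀ {y w} {A : Set} → y ⊑ x → ¬ w ⊑ x → y ⊑ w → A
      no-cross y⊑x w⋢x y⊑w = contradiction (subst (_⊑ x) (isolated w⋢x y⊑w) y⊑x) w⋢x

      reflectZ : ∀ i j → element i ⊑ element j → ZRel i j
      reflectZ zero zero _ = inj₂ refl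
      reflectZ zero (suc zero) _ = inj₁ (refl , refl)
      reflectZ zero (suc (suc zero)) le = no-cross (proj₁ d⊏x) q⋢x le
      reflectZ zero (suc (suc (suc zero))) le = no-cross (proj₁ d⊏x) r⋢x le
      reflectZ (suc zero) zero le = contradiction (antisym (proj₁ d⊏x) le) (proj₂ d⊏x)
      reflectZ (suc zero) (suc zero) _ = inj₂ refl
      reflectZ (suc zero) (suc (suc zero)) le = no-cross ⊑-refl q⋢x le
      reflectZ (suc zero) (suc (suc (suc zero))) le = no-cross ⊑-refl r⋢x le
      reflectZ (suc (suc zero)) zero le = contradiction (⊑-trans le (proj₁ d⊏x)) q⋢x
      reflectZ (suc (suc zero)) (suc zero) le = contradiction le q⋢x
      reflectZ (suc (suc zero)) (suc (suc zero)) _ = inj₂ refl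
      reflectZ (suc (suc zero)) (suc (suc (suc zero))) le = contradiction (sym (isolated r⋢x le)) r≢q
      reflectZ (suc (suc (suc zero))) zero le = contradiction (⊑-trans le (proj₁ d⊏x)) r⋢x
      reflectZ (suc (suc (suc zero))) (suc zero) le = contradiction le r⋢x
      reflectZ (suc (suc (suc zero))) (suc (suc zero)) le = contradiction (isolated q⋢x le) r≢q
      reflectZ (suc (suc (suc zero))) (suc (suc (suc zero))) _ = inj₂ refl

      monoZ : ∀ i j → ZRel i j → element i ⊑ element j
      monoZ zero (suc zero) (inj₁ (refl , refl)) = proj₁ d⊏x
      monoZ i .i (inj₂ refl) = ⊑-refl

      element-injective : ∀ {i j} → element i ≡ element j → i ≡ j
      element-injective {i} {j} eq
        with reflectZ i j (subst (element i ⊑_) eq ⊑-refl) | reflectZ j i (subst (_⊑ element i) eq ⊑-refl)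
      ... | inj₂ i≡j       | _              = i≡j
      ... | inj₁ _         | inj₂ j≡i       = sym j≡i
      ... | inj₁ (i≡0 , _) | inj₁ (_ , i≡1) = case trans (sym i≡0) i≡1 of λ ()

    isZ : IsZ P
    isZ = record
      { to      = proj₁ ∘ index
      ; from    = element
      ; from-to = proj₂ ∘ index
      ; to-from = λ i → element-injective (proj₂ (index (element i)))
      ; mono    = λ y w y⊑w → reflectZ _ _ (subst₂ _⊑_ (sym (proj₂ (index y))) (sym (proj₂ (index w))) y⊑w)
      ; reflect = λ y w R → subst₂ _⊑_ (proj₂ (index y)) (proj₂ (index w)) (monoZ _ _ R)
      }

-- Recognising a chain plus a point.

module _ {c : ℕ} (P : FinPoset (suc c)) (_⊑?_ : Decidable (_≤P_ P)) where

  open Poset P _⊑?_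

  module _ {x q e : Fin (suc c)} (isolated : ∀ {r w} → ¬ r ⊑ x → w ⊑ r → w ≡ r)
    (chain : ∀ {f g} → f ⊑ x → g ⊑ x → f ⊑ g ⊎ g ⊑ f)
    (e⊏x : e ⊏ x) (q⋢x : ¬ q ⊑ x) (only-q : ∀ {r} → ¬ r ⊑ x → r ≡ q) where

    private
      ∣↓∣≤c : ∀ {y} → y ⊑ x → ∣ ↓ y ∣ ≤ c
      ∣↓∣≤c {y} y⊑x = ℕₚ.≤-pred (∣p∣<n (↓ y) λ q∈ → q⋢x (⊑-trans (∈↓⁻ q∈) y⊑x))

      -- Height within the chain, and the last index `c` for the point. Heights stay below `c`
      -- because `q` lies in no down-set of the chain.
      rank : Fin (suc c) → ℕ
      rank y with y ⊑? x
      ... | yes _ = ∣ ↓° y ∣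
      ... | no  _ = c

      rank< : ∀ y → rank y < suc c
      rank< y with y ⊑? x
      ... | yes y⊑x = ℕₚ.m≤n⇒m≤1+n (ℕₚ.<-≤-trans (∣↓°∣<∣↓∣ y) (∣↓∣≤c y⊑x))
      ... | no  _   = ℕₚ.≤-refl

      to : Fin (suc c) → Fin (suc c)
      to y = fromℕ< (rank< y)

      toℕ-to : ∀ y → toℕ (to y) ≡ rank y
      toℕ-to y = toℕ-fromℕ< (rank< y)

      ∣↓°∣-mono : ∀ {y w} → y ⊑ w → ∣ ↓° y ∣ ≤ ∣ ↓° w ∣
      ∣↓°∣-mono y⊑w = p⊆q⇒∣p∣≤∣q∣ λ z∈ →
        let z⊑y , z≢y = ∈↓°⁻ z∈ in
        ∈↓°⁺ (⊑-trans z⊑y y⊑w , λ { refl → z≢y (antisym z⊑y y⊑w) })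

      ∣↓°∣-reflect : ∀ {y w} → y ⊑ x → w ⊑ x → ∣ ↓° y ∣ ≤ ∣ ↓° w ∣ → y ⊑ w
      ∣↓°∣-reflect {y} {w} y⊑x w⊑x le with chain y⊑x w⊑x
      ... | inj₁ y⊑w = y⊑w
      ... | inj₂ w⊑y with ⊑⇒⊏⊎≡ w⊑y
      ...   | inj₂ refl = ⊑-refl
      ...   | inj₁ w⊏y  = contradiction
        (ℕₚ.≤-trans (∣↓°∣<∣↓∣ w) (ℕₚ.≤-trans (p⊆q⇒∣p∣≤∣q∣ λ z∈ → ∈↓°⁺ (⊑-⊏-trans (∈↓⁻ z∈) w⊏y)) le))
        (ℕₚ.<-irrefl refl)

      toℕ-to-chain : ∀ {y} → y ⊑ x → toℕ (to y) ≡ ∣ ↓° y ∣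
      toℕ-to-chain {y} y⊑x = trans (toℕ-to y) rank≡
        where
        rank≡ : rank y ≡ ∣ ↓° y ∣
        rank≡ with y ⊑? x
        ... | yes _   = refl
        ... | no y⋢x = contradiction y⊑x y⋢x

      to-point : ∀ {y} → ¬ y ⊑ x → to y ≡ fromℕ c
      to-point {y} y⋢x = toℕ-injective (trans (toℕ-to y) (trans rank≡ (sym (toℕ-fromℕ c))))
        where
        rank≡ : rank y ≡ c
        rank≡ with y ⊑? x
        ... | yes y⊑x = contradiction y⊑x y⋢x
        ... | no _    = refl

      to-chain≢point : ∀ {y} → y ⊑ x → to y ≢ fromℕ c
      to-chain≢point {y} y⊑x eq = ℕₚ.<⇒≢ (ℕₚ.<-≤-trans (∣↓°∣<∣↓∣ y) (∣↓∣≤c y⊑x))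
        (trans (sym (toℕ-to-chain y⊑x)) (trans (cong toℕ eq) (toℕ-fromℕ c)))

      mono : ∀ y w → y ⊑ w → chainPlusPointRel c (to y) (to w)
      mono y w y⊑w = case w ⊑? x of λ where
        (no  w⋢x) → inj₂ (cong to (isolated w⋢x y⊑w))
        (yes w⊑x) → let y⊑x = ⊑-trans y⊑w w⊑x in
          inj₁ (to-chain≢point y⊑x , to-chain≢point w⊑x ,
                subst₂ _≤_ (sym (toℕ-to-chain y⊑x)) (sym (toℕ-to-chain w⊑x)) (∣↓°∣-mono y⊑w))

      toℕ-≤ : ∀ {i j} → chainPlusPointRel c i j → toℕ i ≤ toℕ j
      toℕ-≤ (inj₁ (_ , _ , le)) = le
      toℕ-≤ (inj₂ refl)         = ℕₚ.≤-refl

      point-≡ : ∀ {i j} → i ≡ fromℕ c ⊎ j ≡ fromℕ c → chainPlusPointRel c i j → i ≡ j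
      point-≡ (inj₁ i≡) (inj₁ (i≢ , _ , _)) = contradiction i≡ i≢
      point-≡ (inj₂ j≡) (inj₁ (_ , j≢ , _)) = contradiction j≡ j≢
      point-≡ _         (inj₂ i≡j)          = i≡j

      reflect : ∀ y w → chainPlusPointRel c (to y) (to w) → y ⊑ w
      reflect y w R = case (y ⊑? x) , (w ⊑? x) of λ where
        (no  y⋢x , no  w⋢x) → subst (y ⊑_) (trans (only-q y⋢x) (sym (only-q w⋢x))) ⊑-refl
        (yes y⊑x , yes w⊑x) → ∣↓°∣-reflect y⊑x w⊑x
          (subst₂ _≤_ (toℕ-to-chain y⊑x) (toℕ-to-chain w⊑x) (toℕ-≤ R))
        (yes y⊑x , no  w⋢x) → contradiction
          (trans (point-≡ (inj₂ (to-point w⋢x)) R) (to-point w⋢x)) (to-chain≢point y⊑x)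
        (no  y⋢x , yes w⊑x) → contradiction
          (trans (sym (point-≡ (inj₁ (to-point y⋢x)) R)) (to-point y⋢x)) (to-chain≢point w⊑x)

      to-injective : ∀ {y w} → to y ≡ to w → y ≡ w
      to-injective eq = antisym (reflect _ _ (inj₂ eq)) (reflect _ _ (inj₂ (sym eq)))

      to-surjective : ∀ j → ∃ λ y → to y ≡ j
      to-surjective = injective⇒surjective to to-injective

    chainPlusPoint : InB P
    -- `2 ≤ c` comes from `1 ≤ ∣ ↓ e ∣ < ∣ ↓ x ∣ ≤ c`.
    chainPlusPoint = c , ℕₚ.≤-trans (ℕₚ.≤-trans (s≤s (ℕₚ.≤-trans (s≤s z≤n) (∣↓°∣<∣↓∣ e))) (∣↓∣-mono-⊏ e⊏x)) (∣↓∣≤c ⊑-refl) , record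
      { to      = to
      ; from    = proj₁ ∘ to-surjective
      ; from-to = λ y → to-injective (proj₂ (to-surjective (to y)))
      ; to-from = proj₂ ∘ to-surjective
      ; mono    = mono
      ; reflect = reflect
      }

-- The size is a successor because `x` inhabits `Fin n`.
inB : ∀ {n} (P : FinPoset n) (_⊑?_ : Decidable (_≤P_ P)) → let open Poset P _⊑?_ in
  ∀ {x q e} → (∀ {r w} → ¬ r ⊑ x → w ⊑ r → w ≡ r) → (∀ {f g} → f ⊑ x → g ⊑ x → f ⊑ g ⊎ g ⊑ f) →
  e ⊏ x → ¬ q ⊑ x → (∀ {r} → ¬ r ⊑ x → r ≡ q) → InB P
inB {suc _} P _⊑?_ = chainPlusPoint P _⊑?_

-- Chains, alone or with isolated points.

module Block {n : ℕ} (P : FinPoset n) (_⊑?_ : Decidable (_≤P_ P)) where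

  open Poset P _⊑?_

  module _ {x e : Fin n} (isolated : ∀ {r w} → ¬ r ⊑ x → w ⊑ r → w ≡ r) (e⊏x : e ⊏ x) where

    private
      2≤∣↓x∣ : 2 ≤ ∣ ↓ x ∣
      2≤∣↓x∣ = ℕₚ.≤-trans (s≤s (ℕₚ.≤-trans (s≤s z≤n) (∣↓°∣<∣↓∣ e))) (∣↓∣-mono-⊏ e⊏x)

      ⊑x≢ : ∀ {y w} → y ⊑ x → ¬ w ⊑ x → y ≢ w
      ⊑x≢ y⊑x w⋢x refl = w⋢x y⊑x

    module _ {q r s : Fin n} (q⋢x : ¬ q ⊑ x) (r⋢x : ¬ r ⊑ x) (s⋢x : ¬ s ⊑ x)
      (r≢q : r ≢ q) (s≢q : s ≢ q) (s≢r : s ≢ r) where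

      private
        -- A view of the index, so that `a`, `b` and the facts about them reduce by matching.
        data Role : Fin n → Set where
          is-q  : Role q
          is-r  : Role r
          is-s  : Role s
          other : ∀ {i} → i ≢ q → i ≢ r → i ≢ s → Role i

        role : ∀ i → Role i
        role i with i ≟ q | i ≟ r | i ≟ s
        ... | yes refl | _        | _        = is-q
        ... | no _     | yes refl | _        = is-r
        ... | no _     | no _     | yes refl = is-s
        ... | no i≢q   | no i≢r   | no i≢s   = other i≢q i≢r i≢s

        a b : ∀ {i} → Role i → Fin n
        a is-q = q
        a is-r = q
        a is-s = r
        a (other {i} _ _ _) = i
        b is-q = x
        b is-r = r
        b is-s = x
        b (other {i} _ _ _) = i

        a⋢x : ∀ {i} (u : Role i) → ¬ i ⊑ x → ¬ a u ⊑ x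
        a⋢x is-q          _ = q⋢x
        a⋢x is-r          _ = q⋢x
        a⋢x is-s          _ = r⋢x
        a⋢x (other _ _ _) i⋢x = i⋢x

        b-nonminimal : ∀ {i} (u : Role i) → ¬ i ⊑ x → b u ⊑ x → ∃ λ d → d ⊏ b u
        b-nonminimal is-q          _   _   = e , e⊏x
        b-nonminimal is-r          _   r⊑x = contradiction r⊑x r⋢x
        b-nonminimal is-s          _   _   = e , e⊏x
        b-nonminimal (other _ _ _) i⋢x i⊑x = contradiction i⊑x i⋢x

        antichain : ∀ {i j} (u : Role i) (v : Role j) → ¬ i ⊑ x → ¬ j ⊑ x → i ≢ j →
                    ¬ ((a u ≡ a v ⊎ a u ≡ b v) × (b u ≡ a v ⊎ b u ≡ b v))
        antichain is-q is-q _ _ i≢j _ = i≢j refl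
        antichain is-q is-r _ _ _ (_ , inj₁ x≡q) = ⊑x≢ ⊑-refl q⋢x x≡q
        antichain is-q is-r _ _ _ (_ , inj₂ x≡r) = ⊑x≢ ⊑-refl r⋢x x≡r
        antichain is-q is-s _ _ _ (inj₁ q≡r , _) = r≢q (sym q≡r)
        antichain is-q is-s _ _ _ (inj₂ q≡x , _) = ⊑x≢ ⊑-refl q⋢x (sym q≡x)
        antichain is-q (other j≢q _ _) _ _ _ (inj₁ q≡j , _) = j≢q (sym q≡j)
        antichain is-q (other j≢q _ _) _ _ _ (inj₂ q≡j , _) = j≢q (sym q≡j)
        antichain is-r is-q _ _ _ (_ , inj₁ r≡q) = r≢q r≡q
        antichain is-r is-q _ _ _ (_ , inj₂ r≡x) = ⊑x≢ ⊑-refl r⋢x (sym r≡x)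
        antichain is-r is-r _ _ i≢j _ = i≢j refl
        antichain is-r is-s _ _ _ (inj₁ q≡r , _) = r≢q (sym q≡r)
        antichain is-r is-s _ _ _ (inj₂ q≡x , _) = ⊑x≢ ⊑-refl q⋢x (sym q≡x)
        antichain is-r (other j≢q _ _) _ _ _ (inj₁ q≡j , _) = j≢q (sym q≡j)
        antichain is-r (other j≢q _ _) _ _ _ (inj₂ q≡j , _) = j≢q (sym q≡j)
        antichain is-s is-q _ _ _ (inj₁ r≡q , _) = r≢q r≡q
        antichain is-s is-q _ _ _ (inj₂ r≡x , _) = ⊑x≢ ⊑-refl r⋢x (sym r≡x)
        antichain is-s is-r _ _ _ (_ , inj₁ x≡q) = ⊑x≢ ⊑-refl q⋢x x≡q
        antichain is-s is-r _ _ _ (_ , inj₂ x≡r) = ⊑x≢ ⊑-refl r⋢x x≡r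
        antichain is-s is-s _ _ i≢j _ = i≢j refl
        antichain is-s (other _ j≢r _) _ _ _ (inj₁ r≡j , _) = j≢r (sym r≡j)
        antichain is-s (other _ j≢r _) _ _ _ (inj₂ r≡j , _) = j≢r (sym r≡j)
        antichain (other i≢q _ _) is-q _ _ _ (inj₁ i≡q , _) = i≢q i≡q
        antichain (other _ _ _) is-q i⋢x _ _ (inj₂ i≡x , _) = ⊑x≢ ⊑-refl i⋢x (sym i≡x)
        antichain (other i≢q _ _) is-r _ _ _ (inj₁ i≡q , _) = i≢q i≡q
        antichain (other _ i≢r _) is-r _ _ _ (inj₂ i≡r , _) = i≢r i≡r
        antichain (other _ i≢r _) is-s _ _ _ (inj₁ i≡r , _) = i≢r i≡r
        antichain (other _ _ _) is-s i⋢x _ _ (inj₂ i≡x , _) = ⊑x≢ ⊑-refl i⋢x (sym i≡x)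
        antichain (other _ _ _) (other _ _ _) _ _ i≢j (inj₁ i≡j , _) = i≢j i≡j
        antichain (other _ _ _) (other _ _ _) _ _ i≢j (inj₂ i≡j , _) = i≢j i≡j

        s≢a : ∀ {i} (u : Role i) → s ≢ a u
        s≢a is-q            = s≢q
        s≢a is-r            = s≢q
        s≢a is-s            = s≢r
        s≢a (other _ _ i≢s) = i≢s ∘ sym

        s≢b : ∀ {i} (u : Role i) → s ≢ b u
        s≢b is-q            = ⊑x≢ ⊑-refl s⋢x ∘ sym
        s≢b is-r            = s≢r
        s≢b is-s            = ⊑x≢ ⊑-refl s⋢x ∘ sym
        s≢b (other _ _ i≢s) = i≢s ∘ sym

      -- Represent q, r, s by {q, x}, {q, r}, {r, x}, so that s is not needed.
      threeIsolated : Improved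
      threeIsolated = isolatedPairs isolated 2≤∣↓x∣ (λ i → a (role i)) (λ i → b (role i))
        (λ {i} → a⋢x (role i)) (λ {i} → b-nonminimal (role i)) (λ {i} {j} → antichain (role i) (role j))
        s⋢x (λ {i} _ → s≢a (role i)) (λ {i} _ → s≢b (role i))

    module _ {q r d : Fin n} (q⋢x : ¬ q ⊑ x) (r⋢x : ¬ r ⊑ x) (r≢q : r ≢ q) (d⊏e : d ⊏ e) where

      private
        e⊑x : e ⊑ x
        e⊑x = proj₁ e⊏x

        data Role : Fin n → Set where
          is-q  : Role q
          is-r  : Role r
          other : ∀ {i} → i ≢ q → i ≢ r → Role i

        role : ∀ i → Role i
        role i with i ≟ q | i ≟ r
        ... | yes refl | _        = is-q
        ... | no _     | yes refl = is-r
        ... | no i≢q   | no i≢r   = other i≢q i≢r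

        a b : ∀ {i} → Role i → Fin n
        a is-q = q
        a is-r = q
        a (other {i} _ _) = i
        b is-q = x
        b is-r = e
        b (other {i} _ _) = i

        a⋢x : ∀ {i} (u : Role i) → ¬ i ⊑ x → ¬ a u ⊑ x
        a⋢x is-q        _   = q⋢x
        a⋢x is-r        _   = q⋢x
        a⋢x (other _ _) i⋢x = i⋢x

        b-nonminimal : ∀ {i} (u : Role i) → ¬ i ⊑ x → b u ⊑ x → ∃ λ f → f ⊏ b u
        b-nonminimal is-q        _   _   = e , e⊏x
        b-nonminimal is-r        _   _   = d , d⊏e
        b-nonminimal (other _ _) i⋢x i⊑x = contradiction i⊑x i⋢x

        antichain : ∀ {i j} (u : Role i) (v : Role j) → ¬ i ⊑ x → ¬ j ⊑ x → i ≢ j →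
                    ¬ ((a u ≡ a v ⊎ a u ≡ b v) × (b u ≡ a v ⊎ b u ≡ b v))
        antichain is-q is-q _ _ i≢j _ = i≢j refl
        antichain is-q is-r _ _ _ (_ , inj₁ x≡q) = ⊑x≢ ⊑-refl q⋢x x≡q
        antichain is-q is-r _ _ _ (_ , inj₂ x≡e) = proj₂ e⊏x (sym x≡e)
        antichain is-r is-q _ _ _ (_ , inj₁ e≡q) = ⊑x≢ e⊑x q⋢x e≡q
        antichain is-r is-q _ _ _ (_ , inj₂ e≡x) = proj₂ e⊏x e≡x
        antichain is-r is-r _ _ i≢j _ = i≢j refl
        antichain is-q (other _ _) _ j⋢x _ (_ , inj₁ x≡j) = ⊑x≢ ⊑-refl j⋢x x≡j
        antichain is-q (other _ _) _ j⋢x _ (_ , inj₂ x≡j) = ⊑x≢ ⊑-refl j⋢x x≡j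
        antichain is-r (other _ _) _ j⋢x _ (_ , inj₁ e≡j) = ⊑x≢ e⊑x j⋢x e≡j
        antichain is-r (other _ _) _ j⋢x _ (_ , inj₂ e≡j) = ⊑x≢ e⊑x j⋢x e≡j
        antichain (other i≢q _) is-q _ _ _ (inj₁ i≡q , _) = i≢q i≡q
        antichain (other _ _) is-q i⋢x _ _ (inj₂ i≡x , _) = ⊑x≢ ⊑-refl i⋢x (sym i≡x)
        antichain (other i≢q _) is-r _ _ _ (inj₁ i≡q , _) = i≢q i≡q
        antichain (other _ _) is-r i⋢x _ _ (inj₂ i≡e , _) = ⊑x≢ e⊑x i⋢x (sym i≡e)
        antichain (other _ _) (other _ _) _ _ i≢j (inj₁ i≡j , _) = i≢j i≡j
        antichain (other _ _) (other _ _) _ _ i≢j (inj₂ i≡j , _) = i≢j i≡j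

        r≢a : ∀ {i} (u : Role i) → r ≢ a u
        r≢a is-q          = r≢q
        r≢a is-r          = r≢q
        r≢a (other _ i≢r) = i≢r ∘ sym

        r≢b : ∀ {i} (u : Role i) → r ≢ b u
        r≢b is-q          = ⊑x≢ ⊑-refl r⋢x ∘ sym
        r≢b is-r          = ⊑x≢ e⊑x r⋢x ∘ sym
        r≢b (other _ i≢r) = i≢r ∘ sym

      -- Represent q, r by {q, x}, {q, e}, so that r is not needed.
      twoIsolated : Improved
      twoIsolated = isolatedPairs isolated 2≤∣↓x∣ (λ i → a (role i)) (λ i → b (role i))
        (λ {i} → a⋢x (role i)) (λ {i} → b-nonminimal (role i)) (λ {i} {j} → antichain (role i) (role j))
        r⋢x (λ {i} _ → r≢a (role i)) (λ {i} _ → r≢b (role i))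

  -- One isolated point gives `C + T`, three or more an improvement. Two give an improvement unless
  -- the chain has just two elements, which leaves `Z`.
  chainPlusIsolated : ∀ {x e q} → (∀ {r w} → ¬ r ⊑ x → w ⊑ r → w ≡ r) →
    (∀ {f g} → f ⊑ x → g ⊑ x → f ⊑ g ⊎ g ⊑ f) → e ⊏ x → ¬ q ⊑ x →
    Improved ⊎ InB P ⊎ IsZ P
  chainPlusIsolated {x} {e} {q} isolated chain e⊏x q⋢x
    with search (λ r → ¬? (r ⊑? x) ×-dec ¬? (r ≟ q))
  ... | inj₂ none = inj₂ (inj₁ (inB P _⊑?_ isolated chain e⊏x q⋢x
    λ {r} r⋢x → decidable-stable (r ≟ q) λ r≢q → none r (r⋢x , r≢q)))
  ... | inj₁ (r , r⋢x , r≢q)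
    with search (λ s → ¬? (s ⊑? x) ×-dec (¬? (s ≟ q) ×-dec ¬? (s ≟ r)))
  ... | inj₁ (s , s⋢x , s≢q , s≢r) = inj₁ (threeIsolated isolated e⊏x q⋢x r⋢x s⋢x r≢q s≢q s≢r)
  -- A nonminimal element strictly below `x` means a chain of at least three elements.
  ... | inj₂ noThird with search (λ f → (f ⊏? x) ×-dec any? (_⊏? f))
  ... | inj₁ (f , f⊏x , d , d⊏f) = inj₁ (twoIsolated isolated f⊏x q⋢x r⋢x r≢q d⊏f)
  ... | inj₂ ⊏x⇒minimal = inj₂ (inj₂ (isZ P _⊑?_ isolated e⊏x q⋢x r⋢x r≢q covered))
    where
    ⊏x⇒≡e : ∀ {y} → y ⊏ x → y ≡ e
    ⊏x⇒≡e {y} y⊏x with chain (proj₁ y⊏x) (proj₁ e⊏x)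
    ... | inj₁ y⊑e with ⊑⇒⊏⊎≡ y⊑e
    ...   | inj₁ y⊏e = contradiction (e⊏x , y , y⊏e) (⊏x⇒minimal e)
    ...   | inj₂ y≡e = y≡e
    ⊏x⇒≡e {y} y⊏x | inj₂ e⊑y with ⊑⇒⊏⊎≡ e⊑y
    ...   | inj₁ e⊏y = contradiction (y⊏x , e , e⊏y) (⊏x⇒minimal y)
    ...   | inj₂ e≡y = sym e≡y

    covered : ∀ y → y ≡ e ⊎ y ≡ x ⊎ y ≡ q ⊎ y ≡ r
    covered y with y ⊑? x | y ≟ q | y ≟ r
    ... | no y⋢x | no y≢q  | no y≢r  = contradiction (y⋢x , y≢q , y≢r) (noThird y)
    ... | no _   | yes y≡q | _       = inj₂ (inj₂ (inj₁ y≡q))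
    ... | no _   | no _    | yes y≡r = inj₂ (inj₂ (inj₂ y≡r))
    ... | yes y⊑x | _ | _ with ⊑⇒⊏⊎≡ y⊑x
    ...   | inj₁ y⊏x = inj₁ (⊏x⇒≡e y⊏x)
    ...   | inj₂ y≡x = inj₂ (inj₁ y≡x)

  -- The least element is the join of the empty set, hence redundant; it is found by minimising
  -- `∣ ↓ y ∣`.
  chain⇒improved : Fin n → IsChain P → Improved
  chain⇒improved x₀ chain with maximum (λ y → n ∸ ∣ ↓ y ∣) x₀
  ... | x , max = dropRedundant {x} λ y _ → bottom y (chain x y)
    where
    bottom : ∀ y → x ⊑ y ⊎ y ⊑ x → x ⊑ y
    bottom y (inj₁ x⊑y) = x⊑y
    bottom y (inj₂ y⊑x) with ⊑⇒⊏⊎≡ y⊑x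
    ... | inj₂ refl = ⊑-refl
    ... | inj₁ y⊏x  = contradiction
      (ℕₚ.∸-monoʳ-< (∣↓∣-mono-⊏ y⊏x) (∣p∣≤n (↓ x))) (ℕₚ.≤⇒≯ (max y))

  -- Comparability from irredundancy.

  Escapes : Fin n → Fin n → Set
  Escapes z y = (∀ w → w ⊏ z → w ⊑ y) × ¬ z ⊑ y

  irredundant⇒escapes : ∀ {z} → ¬ Redundant z → ∃ (Escapes z)
  irredundant⇒escapes {z} ¬redundant
    with search (λ y → all? (λ w → (w ⊏? z) →-dec (w ⊑? y)) ×-dec ¬? (z ⊑? y))
  ... | inj₁ escape = escape
  ... | inj₂ none   = contradiction
    (λ y below → decidable-stable (z ⊑? y) λ z⋢y → none y (below , z⋢y)) ¬redundant

  module _ {x} {D : Fin n → Set}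
    (escape : ∀ z → ∃ (Escapes z)) (⊏⇒D : ∀ {r z} → ¬ r ⊑ x → z ⊏ r → D z) where

    private
      Comparable : Fin n → Set
      Comparable z = ∀ {w} → w ⊑ x → w ⊑ z ⊎ z ⊑ w

      escapes⇒⊏ : ∀ {z y} → Comparable z → Escapes z y → y ⊑ x → y ⊏ z
      escapes⇒⊏ cmp (_ , z⋢y) y⊑x with cmp y⊑x
      ... | inj₁ y⊑z = y⊑z , λ { refl → z⋢y ⊑-refl }
      ... | inj₂ z⊑y = contradiction z⊑y z⋢y

      -- What lies strictly below `z` lies below `y` by the escape, while `z` and everything above
      -- it lie above `y`.
      escapes⇒comparable : ∀ {z y} → Comparable z → Escapes z y → y ⊑ z → Comparable y
      escapes⇒comparable cmp (↓°z⊑y , _) y⊑z w⊑x with cmp w⊑x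
      ... | inj₂ z⊑w = inj₂ (⊑-trans y⊑z z⊑w)
      ... | inj₁ w⊑z with ⊑⇒⊏⊎≡ w⊑z
      ...   | inj₁ w⊏z  = inj₁ (↓°z⊑y _ w⊏z)
      ...   | inj₂ refl = inj₂ y⊑z

    -- Repeated escapes from x form a descending sequence of elements comparable to
    -- everything below x, as long as it does not leave ↓ x.
    comparable : ∀ {f g} → f ⊑ x → g ⊑ x → ¬ D f → f ⊑ g ⊎ g ⊑ f
    comparable {f} {g} f⊑x g⊑x f∉D = descend x ⊑-refl inj₁ f⊑x g⊑x (<-wellFounded _)
      where
      descend : ∀ z → z ⊑ x → Comparable z → f ⊑ z → g ⊑ z → Acc _<_ ∣ ↓ z ∣ → f ⊑ g ⊎ g ⊑ f
      descend z z⊑x cmp f⊑z g⊑z (acc rs) = case (⊑⇒⊏⊎≡ f⊑z , ⊑⇒⊏⊎≡ g⊑z) of λ where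
        (inj₂ refl , _        ) → inj₂ g⊑z
        (inj₁ _    , inj₂ refl) → inj₁ f⊑z
        (inj₁ f⊏z  , inj₁ g⊏z ) → let y , esc = escape z in case y ⊑? x of λ where
          -- Here `f` lies strictly below an element outside `↓ x`, which `⊏⇒D` forbids.
          (no y⋢x)  → contradiction (⊏⇒D y⋢x (proj₁ esc f f⊏z , λ { refl → y⋢x f⊑x })) f∉D
          (yes y⊑x) → let y⊏z = escapes⇒⊏ cmp esc y⊑x in
            descend y y⊑x (escapes⇒comparable cmp esc (proj₁ y⊏z))
              (proj₁ esc f f⊏z) (proj₁ esc g g⊏z) (rs (∣↓∣-mono-⊏ y⊏z))

  -- Classification around an element with a largest down-set.

  module _ (¬vs : ¬ IsVerticalSum P) {x} (x-max : ∀ y → ∣ ↓ y ∣ ≤ ∣ ↓ x ∣) where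

    private
      x-maximal : ∀ {y} → x ⊑ y → x ≡ y
      x-maximal {y} x⊑y with ⊑⇒⊏⊎≡ x⊑y
      ... | inj₁ x⊏y = contradiction (∣↓∣-mono-⊏ x⊏y) (ℕₚ.≤⇒≯ (x-max y))
      ... | inj₂ x≡y = x≡y

      Result : Set
      Result = Improved ⊎ (∀ {y w} → y ⊑ w → y ≡ w) ⊎ InB P ⊎ IsZ P

      -- Failure of `↓° u ⊆ ↓° v`, with its witness.
      Misses : Fin n → Fin n → Set
      Misses u v = ∃ λ z → z ⊏ u × ¬ z ⊏ v

      misses? : Decidable Misses
      misses? u v = any? λ z → (z ⊏? u) ×-dec ¬? (z ⊏? v)

      ¬misses : ∀ {u v} → ¬ Misses u v → ∀ {z} → z ⊏ u → z ⊏ v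
      ¬misses {u} {v} ¬m {z} z⊏u = decidable-stable (z ⊏? v) λ z⋤v → ¬m (z , z⊏u , z⋤v)

      -- The set of `x` becomes `↓° x` with `b` added, of the same size as `↓ x`. A down-set
      -- containing it would also contain `b′` and so exceed the maximum.
      nonminimal-above : ∀ {b b′} → b′ ⊏ b → ¬ b′ ⊑ x → Improved
      nonminimal-above {b} {b′} b′⊏b b′⋢x = replaceMaximal A x-maximal x∉A
        (λ y⊏x → x∈p∪q⁺ (inj₁ (∈↓°⁺ y⊏x))) A⊈↓ ↓⊈A
        (ℕₚ.≤-trans (∣p∪⁅x⁆∣≤ (↓° x) b) (∣↓°∣<∣↓∣ x))
        where
        A : Subset n
        A = ↓° x ∪ ⁅ b ⁆

        b⋢x : ¬ b ⊑ x
        b⋢x b⊑x = b′⋢x (⊑-trans (proj₁ b′⊏b) b⊑x)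

        ∈A⁻ : ∀ {z} → z ∈ A → z ⊏ x ⊎ z ≡ b
        ∈A⁻ z∈ with x∈p∪q⁻ (↓° x) ⁅ b ⁆ z∈
        ... | inj₁ z∈↓° = inj₁ (∈↓°⁻ z∈↓°)
        ... | inj₂ z∈b  = inj₂ (x∈⁅y⁆⇒x≡y b z∈b)

        x∉A : x ∉ A
        x∉A x∈ with ∈A⁻ x∈
        ... | inj₁ x⊏x  = proj₂ x⊏x refl
        ... | inj₂ refl = b⋢x ⊑-refl

        b′∉A : b′ ∉ A
        b′∉A b′∈ with ∈A⁻ b′∈
        ... | inj₁ b′⊏x = b′⋢x (proj₁ b′⊏x)
        ... | inj₂ b′≡b = proj₂ b′⊏b b′≡b

        ∣↓x∣≤∣A∣ : ∣ ↓ x ∣ ≤ ∣ A ∣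
        ∣↓x∣≤∣A∣ = ℕₚ.≤-trans (∣↓∣≤1+∣↓°∣ x) (p⊂q⇒∣p∣<∣q∣
          (p⊆p∪q ⁅ b ⁆ , b , x∈p∪q⁺ (inj₂ (x∈⁅x⁆ b)) , λ b∈ → b⋢x (proj₁ (∈↓°⁻ b∈))))

        A⊈↓ : ∀ {y} → y ≢ x → ¬ A ⊆ ↓ y
        A⊈↓ {y} _ A⊆ = ℕₚ.<-irrefl refl (ℕₚ.<-≤-trans
          (p⊂q⇒∣p∣<∣q∣ (A⊆ , b′ , ∈↓⁺ (⊑-trans (proj₁ b′⊏b) (∈↓⁻ (A⊆ (x∈p∪q⁺ (inj₂ (x∈⁅x⁆ b)))))) , b′∉A))
          (ℕₚ.≤-trans (x-max y) ∣↓x∣≤∣A∣))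

        ↓⊈A : ∀ {y} → ¬ y ⊑ x → ¬ ↓ y ⊆ A
        ↓⊈A y⋢x ↓⊆ with ∈A⁻ (↓⊆ (∈↓⁺ ⊑-refl))
        ... | inj₁ y⊏x  = y⋢x (proj₁ y⊏x)
        ... | inj₂ refl = b′∉A (↓⊆ (∈↓⁺ (proj₁ b′⊏b)))

      module _ (⊏⇒⊑x : ∀ {b b′} → b′ ⊏ b → b′ ⊑ x) where

        ⋢x-maximal : ∀ {q y} → ¬ q ⊑ x → q ⊑ y → q ≡ y
        ⋢x-maximal q⋢x q⊑y with ⊑⇒⊏⊎≡ q⊑y
        ... | inj₁ q⊏y = contradiction (⊏⇒⊑x q⊏y) q⋢x
        ... | inj₂ q≡y = q≡y

        ⊏⇒⊏x : ∀ {q z} → ¬ q ⊑ x → z ⊏ q → z ⊏ x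
        ⊏⇒⊏x q⋢x z⊏q = ⊏⇒⊑x z⊏q , λ { refl → q⋢x (subst (_⊑ x) (x-maximal (proj₁ z⊏q)) ⊑-refl) }

        -- The set of `q` becomes `↓° q` with `x` and `r` added, which have no common upper bound.
        -- The witness `d` makes `↓° q` smaller than `↓° x`, leaving room for both; `d` and `f` keep
        -- `↓ x` and `↓ r` from fitting inside.
        two-incomparable : ∀ {q r} → ¬ q ⊑ x → ¬ r ⊑ x → Misses x q → Misses r q → Improved
        two-incomparable {q} {r} q⋢x r⋢x (d , d⊏x , d⋤q) (f , f⊏r , f⋤q) =
          replaceMaximal A (⋢x-maximal q⋢x) q∉A (λ y⊏q → x∈p∪q⁺ (inj₁ (x∈p∪q⁺ (inj₁ (∈↓°⁺ y⊏q)))))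
            A⊈↓ ↓⊈A
            (ℕₚ.≤-trans (∣p∪⁅x⁆∣≤ (↓° q ∪ ⁅ x ⁆) r)
              (ℕₚ.≤-trans (s≤s (ℕₚ.≤-trans (∣p∪⁅x⁆∣≤ (↓° q) x)
                (p⊂q⇒∣p∣<∣q∣ ((λ z∈ → ∈↓°⁺ (⊏⇒⊏x q⋢x (∈↓°⁻ z∈))) , d , ∈↓°⁺ d⊏x , λ d∈ → d⋤q (∈↓°⁻ d∈)))))
                (∣↓°∣<∣↓∣ x)))
          where
          A : Subset n
          A = (↓° q ∪ ⁅ x ⁆) ∪ ⁅ r ⁆

          ∈A⁻ : ∀ {z} → z ∈ A → z ⊏ q ⊎ z ≡ x ⊎ z ≡ r
          ∈A⁻ z∈ with x∈p∪q⁻ (↓° q ∪ ⁅ x ⁆) ⁅ r ⁆ z∈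
          ... | inj₂ z∈r = inj₂ (inj₂ (x∈⁅y⁆⇒x≡y r z∈r))
          ... | inj₁ z∈′ with x∈p∪q⁻ (↓° q) ⁅ x ⁆ z∈′
          ...   | inj₁ z∈↓° = inj₁ (∈↓°⁻ z∈↓°)
          ...   | inj₂ z∈x  = inj₂ (inj₁ (x∈⁅y⁆⇒x≡y x z∈x))

          x∈A : x ∈ A
          x∈A = x∈p∪q⁺ (inj₁ (x∈p∪q⁺ (inj₂ (x∈⁅x⁆ x))))

          r∈A : r ∈ A
          r∈A = x∈p∪q⁺ (inj₂ (x∈⁅x⁆ r))

          q∉A : q ∉ A
          q∉A q∈ with ∈A⁻ q∈
          ... | inj₁ q⊏q         = proj₂ q⊏q refl
          ... | inj₂ (inj₁ refl) = q⋢x ⊑-refl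
          ... | inj₂ (inj₂ refl) = f⋤q f⊏r

          A⊈↓ : ∀ {y} → y ≢ q → ¬ A ⊆ ↓ y
          A⊈↓ _ A⊆ with refl ← x-maximal (∈↓⁻ (A⊆ x∈A)) = r⋢x (∈↓⁻ (A⊆ r∈A))

          ↓⊈A : ∀ {y} → ¬ y ⊑ q → ¬ ↓ y ⊆ A
          ↓⊈A y⋢q ↓⊆ with ∈A⁻ (↓⊆ (∈↓⁺ ⊑-refl))
          ... | inj₁ y⊏q = y⋢q (proj₁ y⊏q)
          ... | inj₂ (inj₁ refl) with ∈A⁻ (↓⊆ (∈↓⁺ (proj₁ d⊏x)))
          ...   | inj₁ d⊏q         = d⋤q d⊏q
          ...   | inj₂ (inj₁ refl) = proj₂ d⊏x refl
          ...   | inj₂ (inj₂ refl) = r⋢x (proj₁ d⊏x)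
          ↓⊈A y⋢q ↓⊆ | inj₂ (inj₂ refl) with ∈A⁻ (↓⊆ (∈↓⁺ (proj₁ f⊏r)))
          ...   | inj₁ f⊏q         = f⋤q f⊏q
          ...   | inj₂ (inj₁ refl) = proj₂ (⊏⇒⊏x r⋢x f⊏r) refl
          ...   | inj₂ (inj₂ refl) = proj₂ f⊏r refl

        -- If anything lay strictly below `x`, then `↓° x` and its complement would form a vertical
        -- sum. Otherwise no strict comparison remains, since its lower end would have to be the
        -- maximal `x`.
        all-above : (∀ {r z} → ¬ r ⊑ x → z ⊏ x → z ⊏ r) → ∀ {y w} → y ⊑ w → y ≡ w
        all-above above {y} {w} y⊑w with search (_⊏? x)
        ... | inj₁ (d , d⊏x) = contradiction
          (↓° x , (d , ∈↓°⁺ d⊏x) , (x , λ x∈ → proj₂ (∈↓°⁻ x∈) refl) , λ u v u∈ v∉ → split u v (∈↓°⁻ u∈) v∉) ¬vs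
          where
          split : ∀ u v → u ⊏ x → v ∉ ↓° x → u ⊑ v
          split u v u⊏x v∉ with v ⊑? x
          ... | no v⋢x  = proj₁ (above v⋢x u⊏x)
          ... | yes v⊑x with ⊑⇒⊏⊎≡ v⊑x
          ...   | inj₁ v⊏x  = contradiction (∈↓°⁺ v⊏x) v∉
          ...   | inj₂ refl = proj₁ u⊏x
        ... | inj₂ none with ⊑⇒⊏⊎≡ y⊑w
        ...   | inj₂ y≡w = y≡w
        ...   | inj₁ y⊏w with ⊑⇒⊏⊎≡ (⊏⇒⊑x y⊏w)
        ...     | inj₁ y⊏x  = contradiction y⊏x (none y)
        ...     | inj₂ refl = x-maximal y⊑w

        not-all-above : ∀ {q} → ¬ q ⊑ x → Misses x q → (∀ {r} → ¬ r ⊑ x → ¬ Misses r q) →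
                        Improved ⊎ InB P ⊎ IsZ P
        not-all-above {q} q⋢x (e , e⊏x , e⋤q) r⊆q with search redundant?
        ... | inj₁ (z , redundant) = inj₁ (dropRedundant redundant)
        ... | inj₂ irredundant with search (λ r → ¬? (r ⊑? x) ×-dec misses? q r)
        -- The roles of `q` and `r` are exchanged; `e` still witnesses `Misses x r` because
        -- `↓° r ⊆ ↓° q`.
        ... | inj₁ (r , r⋢x , q⊈r) = inj₁ (two-incomparable r⋢x q⋢x
          (e , e⊏x , λ e⊏r → e⋤q (¬misses (r⊆q r⋢x) e⊏r)) q⊈r)
        -- Now `↓° q` is the common strict down-set of all elements outside `↓ x`. If it is
        -- non-empty, it is the lower part of a vertical sum.
        ... | inj₂ q⊆r with search (_⊏? q)
        ... | inj₁ (d , d⊏q) = contradiction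
          (↓° q , (d , ∈↓°⁺ d⊏q) , (q , λ q∈ → proj₂ (∈↓°⁻ q∈) refl) , λ u v u∈ v∉ → split u v (∈↓°⁻ u∈) v∉) ¬vs
          where
          split : ∀ u v → u ⊏ q → v ∉ ↓° q → u ⊑ v
          split u v u⊏q v∉ with v ⊑? x
          ... | no v⋢x  = proj₁ (¬misses (λ m → q⊆r v (v⋢x , m)) u⊏q)
          ... | yes v⊑x with comparable {D = _⊏ q} (irredundant⇒escapes ∘ irredundant) (λ r⋢x → ¬misses (r⊆q r⋢x))
                               v⊑x (⊏⇒⊑x u⊏q) (v∉ ∘ ∈↓°⁺)
          ...   | inj₁ v⊑u = contradiction (∈↓°⁺ (⊑-⊏-trans v⊑u u⊏q)) v∉
          ...   | inj₂ u⊑v = u⊑v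
        -- With `↓° q` empty, `comparable` applies to all of `↓ x`.
        ... | inj₂ none = chainPlusIsolated isolated
          (λ f⊑x g⊑x → comparable {D = _⊏ q} (irredundant⇒escapes ∘ irredundant) (λ r⋢x → ¬misses (r⊆q r⋢x)) f⊑x g⊑x (none _)) e⊏x q⋢x
          where
          isolated : ∀ {r w} → ¬ r ⊑ x → w ⊑ r → w ≡ r
          isolated r⋢x w⊑r with ⊑⇒⊏⊎≡ w⊑r
          ... | inj₁ w⊏r = contradiction (¬misses (r⊆q r⋢x) w⊏r) (none _)
          ... | inj₂ w≡r = w≡r

        classify-antichain-above : Result
        classify-antichain-above with search (λ q → ¬? (q ⊑? x) ×-dec misses? x q)
        ... | inj₂ above = inj₂ (inj₁ (all-above λ r⋢x → ¬misses λ m → above _ (r⋢x , m)))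
        ... | inj₁ (q , q⋢x , x⊈q) with search (λ r → ¬? (r ⊑? x) ×-dec misses? r q)
        ...   | inj₁ (r , r⋢x , r⊈q) = inj₁ (two-incomparable q⋢x r⋢x x⊈q r⊈q)
        ...   | inj₂ r⊆q with not-all-above q⋢x x⊈q (λ {r} r⋢x m → r⊆q r (r⋢x , m))
        ...     | inj₁ improved = inj₁ improved
        ...     | inj₂ listed   = inj₂ (inj₂ listed)

    classify : Result
    classify with search (λ b → any? λ b′ → (b′ ⊏? b) ×-dec ¬? (b′ ⊑? x))
    ... | inj₁ (b , b′ , b′⊏b , b′⋢x) = inj₁ (nonminimal-above b′⊏b b′⋢x)
    ... | inj₂ none = classify-antichain-above λ {b} {b′} b′⊏b →
      decidable-stable (b′ ⊑? x) λ b′⋢x → none b (b′ , b′⊏b , b′⋢x)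

-- Antichains with at least five elements.

module _ {m : ℕ} where

  private
    Label : Set
    Label = Fin 5 ⊎ Fin m

    table : Vec (Subset 4) 5
    table = (inside  ∷ inside  ∷ outside ∷ outside ∷ [])
          ∷ (inside  ∷ outside ∷ inside  ∷ outside ∷ [])
          ∷ (inside  ∷ outside ∷ outside ∷ inside  ∷ [])
          ∷ (outside ∷ inside  ∷ inside  ∷ outside ∷ [])
          ∷ (outside ∷ inside  ∷ outside ∷ inside  ∷ [])
          ∷ []

    table-antichain : ∀ a b → lookup table a ⊆ lookup table b → a ≡ b
    table-antichain = from-yes (all? λ a → all? λ b → (lookup table a ⊆? lookup table b) →-dec (a ≟ b))

    table-nonempty : ∀ a → ¬ lookup table a ⊆ ∅
    table-nonempty = from-yes (all? λ a → ¬? (lookup table a ⊆? ∅))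

    -- Labels beyond the first five get private singletons, so `4 + m` ground elements serve `5 + m`
    -- sets.
    labelSet : Label → Subset (4 + m)
    labelSet (inj₁ a) = lookup table a ++ ∅
    labelSet (inj₂ j) = ∅ {4} ++ ⁅ j ⁆

    labelSet-antichain : ∀ u v → labelSet u ⊆ labelSet v → u ≡ v
    labelSet-antichain (inj₁ a) (inj₁ b) s =
      cong inj₁ (table-antichain a b (proj₁ (++-⊆⁻ (lookup table a) (lookup table b) s)))
    labelSet-antichain (inj₁ a) (inj₂ j) s =
      contradiction (λ {_} → proj₁ (++-⊆⁻ (lookup table a) ∅ s)) (table-nonempty a)
    labelSet-antichain (inj₂ j) (inj₁ a) s =
      contradiction (proj₂ (++-⊆⁻ ∅ (lookup table a) s) (x∈⁅x⁆ j)) ∉⊥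
    labelSet-antichain (inj₂ j) (inj₂ k) s =
      cong inj₂ (x∈⁅y⁆⇒x≡y k (proj₂ (++-⊆⁻ (∅ {4}) ∅ s) (x∈⁅x⁆ j)))

  antichainSets : Fin (5 + m) → Subset (4 + m)
  antichainSets = labelSet ∘ splitAt 5

  antichainSets-antichain : ∀ i j → antichainSets i ⊆ antichainSets j → i ≡ j
  antichainSets-antichain i j s = trans (sym (join-splitAt 5 m i))
    (trans (cong (join 5 m) (labelSet-antichain (splitAt 5 i) (splitAt 5 j) s)) (join-splitAt 5 m j))

-- From shapes to the two dimensions.

module _ {n : ℕ} (P : FinPoset n) where

  -- A `FinPoset` carries no decision procedure for its order; inclusion between finite sets
  -- provides one.
  rep⇒decidable : ∀ {m} {S : Fin n → Subset m} → IsInclusionRep P S → Decidable (_≤P_ P)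
  rep⇒decidable {S = S} rep y w with S y ⊆? S w
  ... | yes s = yes (proj₂ (rep y w) s)
  ... | no ¬s = no λ y⊑w → ¬s (proj₁ (rep y w) y⊑w)

  antichain⇒≅ : (∀ {y w} → _≤P_ P y w → y ≡ w) → P ≅ antichainRel n
  antichain⇒≅ discrete = record
    { to      = id
    ; from    = id
    ; from-to = λ _ → refl
    ; to-from = λ _ → refl
    ; mono    = λ _ _ → discrete
    ; reflect = λ { _ _ refl → IsPartialOrder.refl (isPartialOrder P) }
    }

antichain⇒InA234 : (P : FinPoset n) → 2 ≤ n → (∀ {y w} → _≤P_ P y w → y ≡ w) → IsDim2 P n → InA234 P
antichain⇒InA234 {1} P (s≤s ()) _ _
antichain⇒InA234 {2} P _ discrete _ = 2 , inj₁ refl , antichain⇒≅ P discrete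
antichain⇒InA234 {3} P _ discrete _ = 3 , inj₂ (inj₁ refl) , antichain⇒≅ P discrete
antichain⇒InA234 {4} P _ discrete _ = 4 , inj₂ (inj₂ refl) , antichain⇒≅ P discrete
antichain⇒InA234 {suc (suc (suc (suc (suc m))))} P _ discrete (_ , minimal) =
  contradiction (ℕₚ.≤-trans (minimal _ antichainSets rep) (∣p∣≤n (ground antichainSets))) ℕₚ.1+n≰n
  where
  rep : IsInclusionRep P (antichainSets {m})
  rep y w = (λ y⊑w → subst (λ v → antichainSets y ⊆ antichainSets v) (discrete y⊑w) id) ,
            λ s → subst (_≤P_ P y) (antichainSets-antichain y w s) (IsPartialOrder.refl (isPartialOrder P))

module _ (P : FinPoset n) (_⊑?_ : Decidable (_≤P_ P)) where

  open Poset P _⊑?_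
  open Block P _⊑?_

  improved⇒¬dim2 : Improved → ¬ IsDim2 P n
  improved⇒¬dim2 (_ , S , rep , _ , small) (_ , minimal) = ℕₚ.<⇒≱ small (minimal _ S rep)

  -- When `cw P = n`, `∣↓∣≤∣S∣` bounds every down-set by a set of `T`, hence by `h`. An improvement
  -- therefore respects the bound `h` and beats the minimum.
  improved⇒¬cw : Improved → ¬ IsCw P n
  improved⇒¬cw (_ , S , rep , bound , small) (h , _ , (_ , T , T-rep , T-bound , _) , minimal) =
    ℕₚ.<⇒≱ small (minimal _ S rep λ x → let y , S≤ = bound x in
      ℕₚ.≤-trans S≤ (ℕₚ.≤-trans (Cover.∣↓∣≤∣S∣ T T-rep T-bound minimal y) (T-bound y)))

  block⇒shape : 1 ≤ n → IsBlock P →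
    Improved ⊎ (2 ≤ n × (∀ {y w} → y ⊑ w → y ≡ w)) ⊎ InB P ⊎ IsZ P
  block⇒shape 1≤n (inj₁ chain) = inj₁ (chain⇒improved (fromℕ< 1≤n) chain)
  block⇒shape 1≤n (inj₂ ¬vs) with ℕₚ.m≤n⇒m<n∨m≡n 1≤n
  -- A single element is a chain, so the antichain case below has `2 ≤ n`.
  ... | inj₂ refl = inj₁ (chain⇒improved zero λ { zero zero → inj₁ ⊑-refl })
  ... | inj₁ 2≤n with maximum (∣_∣ ∘ ↓) (fromℕ< 1≤n)
  ...   | x , x-max with classify ¬vs x-max
  ...     | inj₁ improved        = inj₁ improved
  ...     | inj₂ (inj₁ discrete) = inj₂ (inj₁ (2≤n , discrete))
  ...     | inj₂ (inj₂ listed)   = inj₂ (inj₂ listed)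

theorem5p6 : ∀ {n : ℕ} (P : FinPoset n) → 1 ≤ n → IsBlock P →
    (IsDim2 P n → InA234 P ⊎ InB P ⊎ IsZ P)
    × (IsCw P n → InA P ⊎ InB P ⊎ IsZ P)
theorem5p6 {n} P 1≤n block = S1 , S2
  where
  S1 : IsDim2 P n → InA234 P ⊎ InB P ⊎ IsZ P
  S1 dim2@((_ , _ , rep , _) , _) with block⇒shape P (rep⇒decidable P rep) 1≤n block
  ... | inj₁ improved                = contradiction dim2 (improved⇒¬dim2 P (rep⇒decidable P rep) improved)
  ... | inj₂ (inj₁ (2≤n , discrete)) = inj₁ (antichain⇒InA234 P 2≤n discrete dim2)
  ... | inj₂ (inj₂ listed)           = inj₂ listed

  S2 : IsCw P n → InA P ⊎ InB P ⊎ IsZ P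
  S2 cw@(_ , _ , (_ , _ , rep , _) , _) with block⇒shape P (rep⇒decidable P rep) 1≤n block
  ... | inj₁ improved                = contradiction cw (improved⇒¬cw P (rep⇒decidable P rep) improved)
  ... | inj₂ (inj₁ (2≤n , discrete)) = inj₁ (n , 2≤n , antichain⇒≅ P discrete)
  ... | inj₂ (inj₂ listed)           = inj₂ listed
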